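{- For every integer $r\ge 2$ there exist a constant $c>0$ and an integer $v_0$ such that for every integer $v\ge v_0$ there exists a strictly $r$-sparse $4$-cycle packing of order $v$ containing at least $c\cdot v^2$ $4$-cycles.
   Context: A $4$-cycle is a cycle of length four, written $(a,b,c,d)$ with edges $\{a,b\},\{b,c\},\{c,d\},\{d,a\}$; its diagonals are the pairs $\{a,c\}$ and $\{b,d\}$. A $4$-cycle packing of order $w$ is a pair $(W,\mathcal{D})$ with $|W|=w$ and $\mathcal{D}$ a set of pairwise edge-disjoint $4$-cycles whose vertices lie in $W$. A $(k,l)$-configuration in a packing is a set of $l$ of its $4$-cycles whose union contains precisely $k$ vertices. A packing is $r$-sparse if it contains no $(j+3,j)$-configuration for any integer $j$ with $2\le j\le r$. A double-diamond configuration is a pair of $4$-cycles of the form $(a,b,c,d)$ and $(a,e,c,f)$ (six distinct vertices), i.e. two $4$-cycles sharing a common diagonal. A packing is $D$-avoiding if it contains no double-diamond configuration, and strictly $r$-sparse if it is both $r$-sparse and $D$-avoiding. -}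

module Defs where

open import Data.Nat using (ℕ; _≤_; _+_)
open import Data.Fin using (Fin)
open import Data.Fin.Properties using (_≟_)
open import Data.Bool using (Bool; _∨_)
open import Data.List using (List; length; lookup; allFin; filterᵇ)
open import Data.Bool.ListAction using (any)
open import Data.Product using (_×_; ∃; ∃-syntax; Σ-syntax)
open import Data.Sum using (_⊎_)
open import Relation.Nullary using (¬_; ⌊_⌋)
open import Relation.Binary.PropositionalEquality using (_≡_; _≢_)
open import Function.Definitions using (Injective)

record FourCycle (v : ℕ) : Set where
  constructor cyc
  field
    a b c d : Fin v
    a≢b : a ≢ b
    a≢c : a ≢ c
    a≢d : a ≢ d
    b≢c : b ≢ c
    b≢d : b ≢ d
    c≢d : c ≢ d
open FourCycle public

SamePair : ∀ {v} → Fin v → Fin v → Fin v → Fin v → Set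
SamePair x y p q = (x ≡ p × y ≡ q) ⊎ (x ≡ q × y ≡ p)

Edge : ∀ {v} → FourCycle v → Fin v → Fin v → Set
Edge C x y =
  SamePair x y (a C) (b C) ⊎ (SamePair x y (b C) (c C) ⊎
  (SamePair x y (c C) (d C) ⊎ SamePair x y (d C) (a C)))

SameCycle : ∀ {v} → FourCycle v → FourCycle v → Set
SameCycle C C' = ∀ x y → (Edge C x y → Edge C' x y) × (Edge C' x y → Edge C x y)

EdgeDisjoint : ∀ {v} → FourCycle v → FourCycle v → Set
EdgeDisjoint C C' = ¬ (∃[ x ] ∃[ y ] (Edge C x y × Edge C' x y))

-- A 4-cycle packing of order v: a list of 4-cycles on Fin v, entries at
-- distinct positions being edge-disjoint (hence also distinct cycles).
-- The number of 4-cycles in the packing is the length of the list.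
IsPacking : ∀ {v} → List (FourCycle v) → Set
IsPacking D = ∀ (i j : Fin (length D)) → i ≢ j → EdgeDisjoint (lookup D i) (lookup D j)

onCycle : ∀ {v} → Fin v → FourCycle v → Bool
onCycle x C = ⌊ x ≟ a C ⌋ ∨ ⌊ x ≟ b C ⌋ ∨ ⌊ x ≟ c C ⌋ ∨ ⌊ x ≟ d C ⌋

unionSize : ∀ {v l} (D : List (FourCycle v)) → (Fin l → Fin (length D)) → ℕ
unionSize {v} {l} D σ =
  length (filterᵇ (λ x → any (λ t → onCycle x (lookup D (σ t))) (allFin l)) (allFin v))

Configuration : ∀ {v} → List (FourCycle v) → ℕ → ℕ → Set
Configuration D k l =
  Σ[ σ ∈ (Fin l → Fin (length D)) ] (Injective _≡_ _≡_ σ × unionSize D σ ≡ k)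

Sparse : ∀ {v} → ℕ → List (FourCycle v) → Set
Sparse r D = ∀ j → 2 ≤ j → j ≤ r → ¬ Configuration D (j + 3) j

-- a double-diamond configuration: two cycles of D (at distinct positions)
-- of the form (a,b,c,d) and (a,e,c,f) with a,b,c,d,e,f six distinct vertices.
-- C = (a,b,c,d) and C' = (a',e,c',f) are representations of those cycles with
-- a' = a, c' = c; distinctness within each cycle is built into FourCycle, the
-- remaining requirement for six distinct vertices is {b,d} ∩ {e,f} = ∅.
DoubleDiamond : ∀ {v} → List (FourCycle v) → Set
DoubleDiamond {v} D =
  Σ[ i ∈ Fin (length D) ] Σ[ j ∈ Fin (length D) ] (i ≢ j ×
  Σ[ C ∈ FourCycle v ] Σ[ C' ∈ FourCycle v ]
    (SameCycle (lookup D i) C × SameCycle (lookup D j) C' ×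
     a C ≡ a C' × c C ≡ c C' ×
     b C ≢ b C' × b C ≢ d C' × d C ≢ b C' × d C ≢ d C'))

DAvoiding : ∀ {v} → List (FourCycle v) → Set
DAvoiding D = ¬ DoubleDiamond D

StrictlySparse : ∀ {v} → ℕ → List (FourCycle v) → Set
StrictlySparse r D = Sparse r D × DAvoiding D

{-# OPTIONS --safe #-}
module Submission where

-- Alteration method. Fix q large in terms of r, put n = q t with 4 n ≤ v ≤ 8 n, and choose
-- N = n² / q cycles independently and uniformly among the n⁴ four-partite ones. The expected
-- number of j-subsets lying within 2 j + 2 vertices is at most a constant times
-- N ^ j · v ^ (2 j + 2) / n ^ (4 j), hence of order N / q ^ (j - 1); for q large these sum over
-- 2 ≤ j ≤ r to at most N / 2. Deleting one cycle from each such subset leaves N / 2 cycles, no j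
-- of which lie within 2 j + 2 vertices. Since j + 3 ≤ 2 j + 2 this gives sparsity, and the case
-- j = 2 (no two cycles within six vertices) excludes shared edges and double diamonds.

open import Defs
open import Data.Nat
  using (ℕ; _≤_; _*_; _^_; zero; suc; _+_; z≤n; s≤s; _≤?_; NonZero; >-nonZero; _/_; _%_)
open import Data.Nat.Properties
open import Data.Nat.DivMod using (m≡m%n+[m/n]*n; m%n<n; m/n*n≤m; m≥n⇒m/n>0)
open import Data.Nat.ListAction using (sum)
open import Data.Nat.ListAction.Properties using (sum-++)
open import Data.Nat.Tactic.RingSolver using (solve-∀)
open import Data.Fin using (Fin; zero; suc; combine; inject≤)
open import Data.Fin.Properties using (combine-injective; inject≤-injective; injective⇒≤)
  renaming (_≟_ to _≟F_; suc-injective to Fsuc-injective)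
open import Data.Fin.Patterns using (0F; 1F; 2F; 3F)
open import Data.List
  using (List; []; _∷_; _++_; length; lookup; map; concatMap; tabulate; allFin; upTo; filter; filterᵇ)
open import Data.List.Properties using (map-++; map-∘; length-map; length-tabulate)
open import Data.List.Membership.Propositional using (_∈_)
open import Data.List.Membership.Propositional.Properties
  using (∈-allFin; ∈-upTo⁺; ∈-filter⁺; ∈-map⁺; ∈-++⁺ˡ)
open import Data.List.Relation.Unary.Any using (here; there)
import Data.List.Relation.Unary.Any as Any
import Data.List.Relation.Unary.Any.Properties as Any
open import Data.Vec using (Vec; []; _∷_; toList; replicate)
open import Data.Vec.Properties using (length-toList)
open import Data.Product using (_×_; ∃-syntax; Σ-syntax; _,_; proj₁; proj₂)
open import Data.Sum using (inj₁; inj₂)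
open import Data.Bool using (Bool; T)
open import Data.Bool.ListAction using (any)
open import Relation.Nullary.Decidable using (T?)
open import Function using (_∘_)
open import Function.Definitions using (Injective)
open import Relation.Nullary using (¬_; Dec; yes; no; contradiction)
open import Relation.Binary.PropositionalEquality
  using (_≡_; _≢_; refl; sym; trans; cong; cong₂; subst; module ≡-Reasoning)

private variable
  A B : Set
  k n v : ℕ

-- Finite sums over lists.

∑ : List A → (A → ℕ) → ℕ
∑ xs f = sum (map f xs)

∑-cong : ∀ (xs : List A) {f g : A → ℕ} → (∀ x → f x ≡ g x) → ∑ xs f ≡ ∑ xs g
∑-cong []       eq = refl
∑-cong (x ∷ xs) eq = cong₂ _+_ (eq x) (∑-cong xs eq)

∑-mono : ∀ (xs : List A) {f g : A → ℕ} → (∀ x → f x ≤ g x) → ∑ xs f ≤ ∑ xs g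
∑-mono []       le = z≤n
∑-mono (x ∷ xs) le = +-mono-≤ (le x) (∑-mono xs le)

∑-const : ∀ (xs : List A) K → ∑ xs (λ _ → K) ≡ length xs * K
∑-const []       K = refl
∑-const (x ∷ xs) K = cong (K +_) (∑-const xs K)

∑-distrib-+ : ∀ (xs : List A) (f g : A → ℕ) → ∑ xs (λ x → f x + g x) ≡ ∑ xs f + ∑ xs g
∑-distrib-+ []       f g = refl
∑-distrib-+ (x ∷ xs) f g = trans (cong (f x + g x +_) (∑-distrib-+ xs f g))
                                 (interchange (f x) (g x) (∑ xs f) (∑ xs g))
  where
  interchange : ∀ a b c d → a + b + (c + d) ≡ a + c + (b + d)
  interchange = solve-∀

*-distribʳ-∑ : ∀ (xs : List A) (f : A → ℕ) K → ∑ xs f * K ≡ ∑ xs (λ x → f x * K)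
*-distribʳ-∑ []       f K = refl
*-distribʳ-∑ (x ∷ xs) f K = trans (*-distribʳ-+ K (f x) (∑ xs f)) (cong (f x * K +_) (*-distribʳ-∑ xs f K))

*-distribˡ-∑ : ∀ (xs : List A) (f : A → ℕ) K → K * ∑ xs f ≡ ∑ xs (λ x → K * f x)
*-distribˡ-∑ xs f K = trans (*-comm K (∑ xs f))
  (trans (*-distribʳ-∑ xs f K) (∑-cong xs (λ x → *-comm (f x) K)))

∑-comm : ∀ (xs : List A) (ys : List B) (f : A → B → ℕ) →
         ∑ xs (λ x → ∑ ys (f x)) ≡ ∑ ys (λ y → ∑ xs (λ x → f x y))
∑-comm []       ys f = sym (trans (∑-const ys 0) (*-zeroʳ (length ys)))
∑-comm (x ∷ xs) ys f = trans (cong (∑ ys (f x) +_) (∑-comm xs ys f))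
                             (sym (∑-distrib-+ ys (f x) (λ y → ∑ xs (λ x → f x y))))

∑-map : ∀ (g : A → B) (xs : List A) (f : B → ℕ) → ∑ (map g xs) f ≡ ∑ xs (f ∘ g)
∑-map g xs f = cong sum (sym (map-∘ xs))

∑-concatMap : ∀ (g : A → List B) (xs : List A) (f : B → ℕ) →
              ∑ (concatMap g xs) f ≡ ∑ xs (λ x → ∑ (g x) f)
∑-concatMap g []       f = refl
∑-concatMap g (x ∷ xs) f = begin
  sum (map f (g x ++ concatMap g xs))       ≡⟨ cong sum (map-++ f (g x) (concatMap g xs)) ⟩
  sum (map f (g x) ++ map f (concatMap g xs)) ≡⟨ sum-++ (map f (g x)) (map f (concatMap g xs)) ⟩
  ∑ (g x) f + ∑ (concatMap g xs) f          ≡⟨ cong (∑ (g x) f +_) (∑-concatMap g xs f) ⟩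
  ∑ (g x) f + ∑ xs (λ x → ∑ (g x) f)        ∎
  where open ≡-Reasoning

f≤∑ : ∀ {xs : List A} {x} (f : A → ℕ) → x ∈ xs → f x ≤ ∑ xs f
f≤∑ f (here refl) = m≤m+n _ _
f≤∑ f (there x∈)  = m≤n⇒m≤o+n _ (f≤∑ f x∈)

∑≡0⇒f≡0 : ∀ {xs : List A} {x} (f : A → ℕ) → x ∈ xs → ∑ xs f ≡ 0 → f x ≡ 0
∑≡0⇒f≡0 f x∈ eq = n≤0⇒n≡0 (subst (f _ ≤_) eq (f≤∑ f x∈))

-- First-moment principle: an entry above `K` can be discarded without pushing the average of the
-- rest above `K`, and the last entry left cannot itself exceed `K`.
pigeonhole : ∀ (xs : List A) (f : A → ℕ) K → 1 ≤ length xs → ∑ xs f ≤ length xs * K → ∃[ x ] f x ≤ K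
pigeonhole (x ∷ xs) f K _ le with f x ≤? K
... | yes fx≤K = x , fx≤K
... | no fx≰K with xs
...   | []     = contradiction (≤-trans (m≤m+n (f x) 0) (subst (f x + 0 ≤_) (+-identityʳ K) le)) fx≰K
...   | y ∷ ys = pigeonhole (y ∷ ys) f K (s≤s z≤n)
                   (+-cancelˡ-≤ K _ _ (≤-trans (+-monoˡ-≤ (∑ (y ∷ ys) f) (<⇒≤ (≰⇒> fx≰K))) le))

-- Words as outcomes of independent uniform draws, with expectations kept as unnormalised sums.

words : ∀ k → List A → List (Vec A k)
words zero    xs = [] ∷ []
words (suc k) xs = concatMap (λ x → map (x ∷_) (words k xs)) xs

∑-words : ∀ k (xs : List A) (F : Vec A (suc k) → ℕ) →
          ∑ (words (suc k) xs) F ≡ ∑ xs (λ x → ∑ (words k xs) (λ s → F (x ∷ s)))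
∑-words k xs F = trans (∑-concatMap _ xs F) (∑-cong xs (λ x → ∑-map (x ∷_) (words k xs) F))

length≡∑1 : ∀ (xs : List A) → length xs ≡ ∑ xs (λ _ → 1)
length≡∑1 xs = sym (trans (∑-const xs 1) (*-identityʳ (length xs)))

length-words : ∀ k (xs : List A) → length (words k xs) ≡ length xs ^ k
length-words zero    xs = refl
length-words (suc k) xs = begin
  length (words (suc k) xs)           ≡⟨ length≡∑1 (words (suc k) xs) ⟩
  ∑ (words (suc k) xs) (λ _ → 1)      ≡⟨ ∑-words k xs (λ _ → 1) ⟩
  ∑ xs (λ _ → ∑ (words k xs) (λ _ → 1))
    ≡⟨ ∑-cong xs (λ _ → trans (sym (length≡∑1 (words k xs))) (length-words k xs)) ⟩
  ∑ xs (λ _ → length xs ^ k)          ≡⟨ ∑-const xs _ ⟩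
  length xs * length xs ^ k           ∎
  where open ≡-Reasoning

∈-words : ∀ {xs : List A} → (∀ x → x ∈ xs) → (s : Vec A k) → s ∈ words k xs
∈-words all []      = here refl
∈-words {xs = xs} all (x ∷ s) = go (all x)
  where
  go : ∀ {ys} → x ∈ ys → (x ∷ s) ∈ concatMap (λ y → map (y ∷_) (words _ xs)) ys
  go (here refl) = ∈-++⁺ˡ (∈-map⁺ (x ∷_) (∈-words all s))
  go (there {y} x∈) = Any.++⁺ʳ (map (y ∷_) (words _ xs)) (go x∈)

prod : (Fin k → A → ℕ) → Vec A k → ℕ
prod f []      = 1
prod f (x ∷ s) = f zero x * prod (f ∘ suc) s

-- Independence of the letters: the sum over words of a product factors into a product of sums over
-- single letters.
∑-prod≤ : ∀ (xs : List A) K (f : Fin k → A → ℕ) → (∀ i → ∑ xs (f i) ≤ K) →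
          ∑ (words k xs) (prod f) ≤ K ^ k
∑-prod≤ {k = zero}  xs K f le = ≤-refl
∑-prod≤ {k = suc k} xs K f le = begin
  ∑ (words (suc k) xs) (prod f)
    ≡⟨ ∑-words k xs (prod f) ⟩
  ∑ xs (λ x → ∑ (words k xs) (λ s → f zero x * prod (f ∘ suc) s))
    ≡⟨ ∑-cong xs (λ x → sym (*-distribˡ-∑ (words k xs) (prod (f ∘ suc)) (f zero x))) ⟩
  ∑ xs (λ x → f zero x * ∑ (words k xs) (prod (f ∘ suc)))
    ≡⟨ sym (*-distribʳ-∑ xs (f zero) _) ⟩
  ∑ xs (f zero) * ∑ (words k xs) (prod (f ∘ suc))
    ≤⟨ *-mono-≤ (le zero) (∑-prod≤ xs K (f ∘ suc) (le ∘ suc)) ⟩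
  K * K ^ k ∎
  where open ≤-Reasoning

-- Random subsequences.

-- The sum of F over the j-element subsequences of a list.
∑⊆ : ∀ j → (Vec A j → ℕ) → List A → ℕ
∑⊆ zero    F xs       = F []
∑⊆ (suc j) F []       = 0
∑⊆ (suc j) F (x ∷ xs) = ∑⊆ j (λ s → F (x ∷ s)) xs + ∑⊆ (suc j) F xs

∑⊆-mono : ∀ j {F G : Vec A j → ℕ} → (∀ s → F s ≤ G s) → ∀ xs → ∑⊆ j F xs ≤ ∑⊆ j G xs
∑⊆-mono zero    le xs       = le []
∑⊆-mono (suc j) le []       = z≤n
∑⊆-mono (suc j) le (x ∷ xs) = +-mono-≤ (∑⊆-mono j (λ s → le (x ∷ s)) xs) (∑⊆-mono (suc j) le xs)

-- Pascal's rule for the bound `m ^ j` in place of the binomial coefficient; the left side is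
-- `suc m * m ^ j` by definition.
1+m^j≤ : ∀ m j → m ^ j + m ^ suc j ≤ suc m ^ suc j
1+m^j≤ m j = *-monoʳ-≤ (suc m) (^-monoˡ-≤ j (n≤1+n m))

-- A j-subset of the N positions of a uniformly random word is a uniformly random
-- j-tuple, and there are at most N ^ j such subsets.
∑⊆-average : ∀ (xs : List A) N j (F : Vec A j → ℕ) →
  ∑ (words N xs) (λ h → ∑⊆ j F (toList h)) * length xs ^ j
    ≤ N ^ j * (length xs ^ N * ∑ (words j xs) F)
∑⊆-average xs N zero F = ≤-reflexive (begin
  ∑ (words N xs) (λ _ → F []) * 1   ≡⟨ *-identityʳ _ ⟩
  ∑ (words N xs) (λ _ → F [])       ≡⟨ ∑-const (words N xs) (F []) ⟩
  length (words N xs) * F []        ≡⟨ cong₂ _*_ (length-words N xs) (sym (+-identityʳ (F []))) ⟩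
  length xs ^ N * (F [] + 0)        ≡⟨ sym (*-identityˡ _) ⟩
  1 * (length xs ^ N * (F [] + 0))  ∎)
  where open ≡-Reasoning
∑⊆-average xs zero    (suc j) F = z≤n
∑⊆-average xs (suc N) (suc j) F = begin
  ∑ (words (suc N) xs) (λ h → ∑⊆ (suc j) F (toList h)) * L ^ suc j
    ≡⟨ cong (_* L ^ suc j) (∑-words N xs _) ⟩
  ∑ xs (λ x → ∑ (words N xs) (λ h → ∑⊆ j (F′ x) (toList h) + ∑⊆ (suc j) F (toList h))) * L ^ suc j
    ≡⟨ cong (_* L ^ suc j) (∑-cong xs (λ x → ∑-distrib-+ (words N xs) _ _)) ⟩
  ∑ xs (λ x → S x + S⁺) * L ^ suc j
    ≡⟨ cong (_* L ^ suc j) (trans (∑-distrib-+ xs S (λ _ → S⁺)) (cong (∑ xs S +_) (∑-const xs S⁺))) ⟩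
  (∑ xs S + L * S⁺) * (L * L ^ j)
    ≡⟨ rearrange (∑ xs S) L S⁺ (L ^ j) ⟩
  L * (∑ xs S * L ^ j) + L * (S⁺ * L ^ suc j)
    ≤⟨ +-mono-≤ (*-monoʳ-≤ L S≤) (*-monoʳ-≤ L (∑⊆-average xs N (suc j) F)) ⟩
  L * (N ^ j * (L ^ N * Σ⁺)) + L * (N ^ suc j * (L ^ N * Σ⁺))
    ≡⟨ collect L (N ^ j) (N ^ suc j) (L ^ N) Σ⁺ ⟩
  (N ^ j + N ^ suc j) * (L * L ^ N * Σ⁺)
    -- The two summands count the position sets that contain the first position and those that avoid
    -- it.
    ≤⟨ *-monoˡ-≤ _ (1+m^j≤ N j) ⟩
  suc N ^ suc j * (L ^ suc N * Σ⁺) ∎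
  where
  open ≤-Reasoning
  L = length xs
  F′ = λ x s → F (x ∷ s)
  S = λ x → ∑ (words N xs) (λ h → ∑⊆ j (F′ x) (toList h))
  S⁺ = ∑ (words N xs) (λ h → ∑⊆ (suc j) F (toList h))
  Σ⁺ = ∑ (words (suc j) xs) F
  rearrange : ∀ a l b p → (a + l * b) * (l * p) ≡ l * (a * p) + l * (b * (l * p))
  rearrange = solve-∀
  collect : ∀ l a b p s → l * (a * (p * s)) + l * (b * (p * s)) ≡ (a + b) * (l * p * s)
  collect = solve-∀
  S≤ : ∑ xs S * L ^ j ≤ N ^ j * (L ^ N * Σ⁺)
  S≤ = begin
    ∑ xs S * L ^ j
      ≡⟨ *-distribʳ-∑ xs S (L ^ j) ⟩
    ∑ xs (λ x → S x * L ^ j)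
      ≤⟨ ∑-mono xs (λ x → ∑⊆-average xs N j (F′ x)) ⟩
    ∑ xs (λ x → N ^ j * (L ^ N * ∑ (words j xs) (F′ x)))
      ≡⟨ sym (*-distribˡ-∑ xs _ (N ^ j)) ⟩
    N ^ j * ∑ xs (λ x → L ^ N * ∑ (words j xs) (F′ x))
      ≡⟨ cong (N ^ j *_) (sym (*-distribˡ-∑ xs _ (L ^ N))) ⟩
    N ^ j * (L ^ N * ∑ xs (λ x → ∑ (words j xs) (F′ x)))
      ≡⟨ cong (λ z → N ^ j * (L ^ N * z)) (sym (∑-words j xs F)) ⟩
    N ^ j * (L ^ N * Σ⁺) ∎

-- Alteration by deletion.

module Deletion {A : Set} (is : List ℕ) (size : ℕ → ℕ) (F : ∀ i → Vec A (suc (size i)) → ℕ) where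

  -- The arity `suc (size i)` excludes the empty subsequence, whose contribution no deletion could
  -- remove; every counted subsequence thus has a head to charge.
  weight : List A → ℕ
  weight xs = ∑ is (λ i → ∑⊆ (suc (size i)) (F i) xs)

  weightAt : A → List A → ℕ
  weightAt x xs = ∑ is (λ i → ∑⊆ (size i) (λ s → F i (x ∷ s)) xs)

  weight-∷ : ∀ x xs → weight (x ∷ xs) ≡ weightAt x xs + weight xs
  weight-∷ x xs = ∑-distrib-+ is _ _

  -- Works from the right, dropping `x` exactly when some subsequence headed by `x` and continued in
  -- the kept tail has positive weight. Comparing all sums `∑⊆` stands in for `ys` being a sublist
  -- of `xs`, and is the form in which the induction uses it.
  prune : ∀ xs → Σ[ ys ∈ List A ]
    (weight ys ≡ 0 × (∀ j G → ∑⊆ j G ys ≤ ∑⊆ j G xs) × length xs ≤ length ys + weight xs)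
  prune [] = [] , trans (∑-const is 0) (*-zeroʳ (length is)) , (λ j G → ≤-refl) , z≤n
  prune (x ∷ xs) with prune xs
  ... | ys , w≡0 , ys≤xs , len with weightAt x ys in eq
  ...   | zero = x ∷ ys , trans (weight-∷ x ys) (cong₂ _+_ eq w≡0) , x∷ys≤x∷xs ,
                 s≤s (≤-trans len (+-monoʳ-≤ (length ys)
                   (≤-trans (m≤n+m _ _) (≤-reflexive (sym (weight-∷ x xs))))))
    where
    x∷ys≤x∷xs : ∀ j G → ∑⊆ j G (x ∷ ys) ≤ ∑⊆ j G (x ∷ xs)
    x∷ys≤x∷xs zero    G = ≤-refl
    x∷ys≤x∷xs (suc j) G = +-mono-≤ (ys≤xs j (λ s → G (x ∷ s))) (ys≤xs (suc j) G)
  ...   | suc e = ys , w≡0 , ys≤x∷xs , (begin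
      suc (length xs)                                 ≤⟨ s≤s len ⟩
      suc (length ys + weight xs)                     ≡⟨ sym (+-suc (length ys) (weight xs)) ⟩
      length ys + (1 + weight xs)                     ≤⟨ +-monoʳ-≤ (length ys) (+-monoˡ-≤ (weight xs) 1≤weightAt) ⟩
      length ys + (weightAt x xs + weight xs)         ≡⟨ cong (length ys +_) (sym (weight-∷ x xs)) ⟩
      length ys + weight (x ∷ xs)                     ∎)
    where
    open ≤-Reasoning
    1≤weightAt : 1 ≤ weightAt x xs
    -- The test was made against the kept tail `ys`; passing to the full tail `xs` only increases
    -- the sum, so the weight headed by `x` pays for its deletion.
    1≤weightAt = ≤-trans (subst (1 ≤_) (sym eq) (s≤s z≤n))
                         (∑-mono is (λ i → ys≤xs (size i) (λ s → F i (x ∷ s))))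
    ys≤x∷xs : ∀ j G → ∑⊆ j G ys ≤ ∑⊆ j G (x ∷ xs)
    ys≤x∷xs zero    G = ≤-refl
    ys≤x∷xs (suc j) G = ≤-trans (ys≤xs (suc j) G) (m≤n+m _ _)

-- From injective choices of positions to subsequences.

module _ {P : A → Set} (P? : ∀ x → Dec (P x)) where

  rank : ∀ xs (i : Fin (length xs)) → P (lookup xs i) → Fin (length (filter P? xs))
  rank (x ∷ xs) zero p with P? x
  ... | yes _ = zero
  ... | no ¬p = contradiction p ¬p
  rank (x ∷ xs) (suc i) p with P? x
  ... | yes _ = suc (rank xs i p)
  ... | no  _ = rank xs i p

  rank-injective : ∀ xs i j p q → rank xs i p ≡ rank xs j q → i ≡ j
  rank-injective (x ∷ xs) zero    zero    p q eq = refl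
  rank-injective (x ∷ xs) zero    (suc j) p q eq with P? x
  rank-injective (x ∷ xs) zero    (suc j) p q () | yes _
  ... | no ¬p = contradiction p ¬p
  rank-injective (x ∷ xs) (suc i) zero    p q eq with P? x
  rank-injective (x ∷ xs) (suc i) zero    p q () | yes _
  ... | no ¬q = contradiction q ¬q
  rank-injective (x ∷ xs) (suc i) (suc j) p q eq with P? x
  ... | yes _ = cong suc (rank-injective xs i j p q (Fsuc-injective eq))
  ... | no  _ = cong suc (rank-injective xs i j p q eq)

  -- Greedy choice: the first `j` entries satisfying `P` form a subsequence whose product is
  -- positive.
  ∑⊆-prod-filter : ∀ {δ : A → ℕ} → (∀ {x} → P x → 1 ≤ δ x) → ∀ j xs →
    j ≤ length (filter P? xs) → 1 ≤ ∑⊆ j (prod (λ _ → δ)) xs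
  ∑⊆-prod-filter pos zero    xs       le = ≤-refl
  ∑⊆-prod-filter {δ} pos (suc j) (x ∷ xs) le with P? x
  ... | yes p = ≤-trans
    (≤-trans (∑⊆-prod-filter pos j xs (≤-pred le)) (∑⊆-mono j (λ s → m≤n*m _ (δ x) {{>-nonZero (pos p)}}) xs))
    (m≤m+n _ _)
  ... | no _  = ≤-trans (∑⊆-prod-filter pos (suc j) xs le) (m≤n+m _ _)

-- `σ` may list its positions in any order, while `∑⊆` sees only increasing ones. Since every
-- coordinate carries the same `δ`, no sorting is required: `rank` turns `σ` into an injection
-- showing that at least `j` entries have positive `δ`.
∑⊆-prod-positive : ∀ (δ : A → ℕ) {j} xs (σ : Fin j → Fin (length xs)) → Injective _≡_ _≡_ σ →
  (∀ t → 1 ≤ δ (lookup xs (σ t))) → 1 ≤ ∑⊆ j (prod (λ _ → δ)) xs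
∑⊆-prod-positive δ xs σ inj p = ∑⊆-prod-filter P? (λ 1≤δ → 1≤δ) _ xs
  (injective⇒≤ {f = λ t → rank P? xs (σ t) (p t)} (λ eq → inj (rank-injective P? xs _ _ _ _ eq)))
  where
  P? = λ x → 1 ≤? δ x

-- Multiplicities of vertices in a word.

indicator : Fin v → Fin v → ℕ
indicator x y with x ≟F y
... | yes _ = 1
... | no  _ = 0

indicator-refl : ∀ (x : Fin v) → indicator x x ≡ 1
indicator-refl x with x ≟F x
... | yes _  = refl
... | no x≢x = contradiction refl x≢x

indicator-≢ : ∀ {x y : Fin v} → x ≢ y → indicator x y ≡ 0
indicator-≢ {x = x} {y} x≢y with x ≟F y
... | yes x≡y = contradiction x≡y x≢y
... | no  _   = refl

-- Stated for `tabulate f` rather than `allFin n` so that the induction can pass to `f ∘ suc`.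
∑-indicator≤1 : ∀ (f : Fin n → A) (e : A → Fin v) y → Injective _≡_ _≡_ (e ∘ f) →
                ∑ (tabulate f) (λ x → indicator (e x) y) ≤ 1
∑-indicator≤1 {n = zero}  f e y inj = z≤n
∑-indicator≤1 {n = suc n} f e y inj with e (f zero) ≟F y
... | no _    = ∑-indicator≤1 (f ∘ suc) e y (Fsuc-injective ∘ inj)
... | yes eq  = s≤s (≤-reflexive (vanishes (f ∘ suc) λ i efi≡y → 0≢1+i (inj (trans eq (sym efi≡y)))))
  where
  0≢1+i : ∀ {i : Fin n} → zero ≢ suc i
  0≢1+i ()
  vanishes : ∀ {k} (g : Fin k → _) → (∀ i → e (g i) ≢ y) → ∑ (tabulate g) (λ x → indicator (e x) y) ≡ 0
  vanishes {zero}  g e≢y = refl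
  vanishes {suc k} g e≢y = cong₂ _+_ (indicator-≢ (e≢y zero)) (vanishes (g ∘ suc) (e≢y ∘ suc))

mult : List (Fin v) → Fin v → ℕ
mult w x = ∑ w (indicator x)

-- Double counting: an injective `e` hits each entry of `w` at most once. Counting with multiplicity
-- lets `w` repeat vertices.
∑-mult≤ : ∀ (w : List (Fin v)) (e : Fin n → Fin v) → Injective _≡_ _≡_ e →
          ∑ (allFin n) (λ x → mult w (e x)) ≤ length w
∑-mult≤ {n = n} w e inj = begin
  ∑ (allFin n) (λ x → ∑ w (indicator (e x)))        ≡⟨ ∑-comm (allFin n) w _ ⟩
  ∑ w (λ y → ∑ (allFin n) (λ x → indicator (e x) y)) ≤⟨ ∑-mono w (λ y → ∑-indicator≤1 (λ x → x) e y inj) ⟩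
  ∑ w (λ _ → 1)                                     ≡⟨ sym (length≡∑1 w) ⟩
  length w                                          ∎
  where open ≤-Reasoning

mult-positive : ∀ {w : List (Fin v)} {x} → x ∈ w → 1 ≤ mult w x
mult-positive {w = w} {x} x∈w = subst (_≤ mult w x) (indicator-refl x) (f≤∑ (indicator x) x∈w)

-- The trailing `* 1` makes this agree definitionally with `prod` over the four coordinates.
multC : List (Fin v) → FourCycle v → ℕ
multC w C = mult w (a C) * (mult w (b C) * (mult w (c C) * (mult w (d C) * 1)))

Covers : List (Fin v) → FourCycle v → Set
Covers w C = a C ∈ w × b C ∈ w × c C ∈ w × d C ∈ w

Covers-mono : ∀ {w w′ : List (Fin v)} {C} → (∀ {x} → x ∈ w → x ∈ w′) → Covers w C → Covers w′ C
Covers-mono w⊆w′ (a∈ , b∈ , c∈ , d∈) = w⊆w′ a∈ , w⊆w′ b∈ , w⊆w′ c∈ , w⊆w′ d∈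

multC-positive : ∀ {w : List (Fin v)} {C} → Covers w C → 1 ≤ multC w C
multC-positive (a∈ , b∈ , c∈ , d∈) =
  *-mono-≤ (mult-positive a∈) (*-mono-≤ (mult-positive b∈) (*-mono-≤ (mult-positive c∈)
    (*-mono-≤ (mult-positive d∈) ≤-refl)))

-- Four-partite cycles.

module Partite (n v : ℕ) (4n≤v : 4 * n ≤ v) where

  -- Disjoint parts make the four vertices distinct automatically, so the sample space is a full
  -- product and sums over it factor.
  emb : Fin 4 → Fin n → Fin v
  emb i x = inject≤ (combine i x) 4n≤v

  emb-injective : ∀ i j {x y} → emb i x ≡ emb j y → i ≡ j × x ≡ y
  emb-injective i j {x} {y} eq = combine-injective i x j y (inject≤-injective 4n≤v 4n≤v _ _ eq)

  emb-≢ : ∀ i j {x y} → i ≢ j → emb i x ≢ emb j y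
  emb-≢ i j i≢j eq = i≢j (proj₁ (emb-injective i j eq))

  toCycle : Vec (Fin n) 4 → FourCycle v
  toCycle (x ∷ y ∷ z ∷ t ∷ []) = record
    { a = emb 0F x ; b = emb 1F y ; c = emb 2F z ; d = emb 3F t
    ; a≢b = emb-≢ 0F 1F λ () ; a≢c = emb-≢ 0F 2F λ () ; a≢d = emb-≢ 0F 3F λ ()
    ; b≢c = emb-≢ 1F 2F λ () ; b≢d = emb-≢ 1F 3F λ () ; c≢d = emb-≢ 2F 3F λ () }

  cycles : List (FourCycle v)
  cycles = map toCycle (words 4 (allFin n))

  length-cycles : length cycles ≡ n ^ 4
  length-cycles = trans (length-map toCycle (words 4 (allFin n)))
    (trans (length-words 4 (allFin n)) (cong (_^ 4) (length-tabulate {n = n} (λ x → x))))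

  ∑-multC≤ : ∀ w → ∑ cycles (multC w) ≤ length w ^ 4
  ∑-multC≤ w = begin
    ∑ cycles (multC w)
      ≡⟨ ∑-map toCycle (words 4 (allFin n)) (multC w) ⟩
    ∑ (words 4 (allFin n)) (multC w ∘ toCycle)
      ≡⟨ ∑-cong (words 4 (allFin n)) (λ { (x ∷ y ∷ z ∷ t ∷ []) → refl }) ⟩
    ∑ (words 4 (allFin n)) (prod (λ i x → mult w (emb i x)))
      ≤⟨ ∑-prod≤ (allFin n) (length w) _ (λ i → ∑-mult≤ w (emb i) (λ eq → proj₂ (emb-injective i i eq))) ⟩
    length w ^ 4 ∎
    where open ≤-Reasoning

-- Expected crowding; throughout, the number of cycles is `j = 2 + i`.

span : ℕ → ℕ
span i = 2 * (3 + i)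

-- Overestimates, by multiplicity, whether 2 + i cycles lie within 2 (2 + i) + 2 vertices.
crowding : ∀ i → Vec (FourCycle v) (2 + i) → ℕ
crowding {v} i s = ∑ (words (span i) (allFin v)) (λ w → prod (λ _ → multC (toList w)) s)

-- The first factor is the price of replacing `v` by `n` under `v ≤ 8 * n`; the second bounds the
-- ways to choose `2 + i` cycles inside one word of length `span i`.
load : ℕ → ℕ
load i = 8 ^ span i * (span i ^ 4) ^ (2 + i)

^-distribʳ-* : ∀ m n o → (m * n) ^ o ≡ m ^ o * n ^ o
^-distribʳ-* m n zero    = refl
^-distribʳ-* m n (suc o) = trans (cong (m * n *_) (^-distribʳ-* m n o)) (interchange m n (m ^ o) (n ^ o))
  where
  interchange : ∀ a b c d → a * b * (c * d) ≡ a * c * (b * d)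
  interchange = solve-∀

module _ {n v : ℕ} (4n≤v : 4 * n ≤ v) where
  open Partite n v 4n≤v

  -- Exchanging the sums fixes the word first; the cycles are then chosen independently, each
  -- contributing at most `span i ^ 4`.
  ∑-crowding≤ : ∀ i → ∑ (words (2 + i) cycles) (crowding i) ≤ v ^ span i * (span i ^ 4) ^ (2 + i)
  ∑-crowding≤ i = begin
    ∑ (words (2 + i) cycles) (crowding i)
      ≡⟨ ∑-comm (words (2 + i) cycles) W _ ⟩
    ∑ W (λ w → ∑ (words (2 + i) cycles) (prod (λ _ → multC (toList w))))
      ≤⟨ ∑-mono W (λ w → ∑-prod≤ cycles (span i ^ 4) _ (λ _ →
           subst (λ l → ∑ cycles (multC (toList w)) ≤ l ^ 4) (length-toList w) (∑-multC≤ (toList w)))) ⟩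
    ∑ W (λ _ → (span i ^ 4) ^ (2 + i))
      ≡⟨ ∑-const W _ ⟩
    length W * (span i ^ 4) ^ (2 + i)
      ≡⟨ cong (_* (span i ^ 4) ^ (2 + i))
           (trans (length-words (span i) (allFin v)) (cong (_^ span i) (length-tabulate {n = v} (λ x → x)))) ⟩
    v ^ span i * (span i ^ 4) ^ (2 + i) ∎
    where
    open ≤-Reasoning
    W = words (span i) (allFin v)

  -- Everything is multiplied by `E`, the number of `j`-tuples of cycles, which is cancelled at the
  -- end. The expectation is thereby at most `load i * N / q`.
  crowding-average : ∀ N q .{{_ : NonZero n}} .{{_ : NonZero q}} → v ≤ 8 * n → N * q ≡ n ^ 2 → ∀ i →
    ∑ (words N cycles) (λ h → ∑⊆ (2 + i) (crowding i) (toList h)) * q ≤ (n ^ 4) ^ N * (load i * N)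
  crowding-average N q v≤8n Nq≡n² i = *-cancelʳ-≤ _ _ E {{m^n≢0 (n ^ 4) (2 + i) {{m^n≢0 n 4}}}} (begin
    S * q * E
      ≡⟨ swap S q E ⟩
    S * E * q
      ≤⟨ *-monoˡ-≤ q avg ⟩
    N ^ (2 + i) * (P * ∑ (words (2 + i) cycles) (crowding i)) * q
      ≤⟨ *-monoˡ-≤ q (*-monoʳ-≤ (N ^ (2 + i)) (*-monoʳ-≤ P (≤-trans (∑-crowding≤ i)
           (*-monoˡ-≤ K (^-monoˡ-≤ ℓ v≤8n))))) ⟩
    N ^ (2 + i) * (P * ((8 * n) ^ ℓ * K)) * q
      ≡⟨ cong (λ z → N ^ (2 + i) * (P * (z * K)) * q) (^-distribʳ-* 8 n ℓ) ⟩
    N ^ (2 + i) * (P * (8 ^ ℓ * n ^ ℓ * K)) * q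
      ≡⟨ regroup N (N ^ i) P (8 ^ ℓ) (n ^ ℓ) K q ⟩
    P * (8 ^ ℓ * K * N) * (N * q * N ^ i * n ^ ℓ)
      -- One factor `q` is enough: bounding `N ^ i` by `(N * q) ^ i` gives up the other `i` factors
      -- and leaves a power of `n ^ 2`.
      ≤⟨ *-monoʳ-≤ (P * (load i * N)) (*-monoˡ-≤ (n ^ ℓ) (*-monoʳ-≤ (N * q) (^-monoˡ-≤ i (m≤m*n N q)))) ⟩
    P * (load i * N) * ((N * q) ^ (1 + i) * n ^ ℓ)
      ≡⟨ cong (λ z → P * (load i * N) * z) exponents ⟩
    P * (load i * N) * E ∎)
    where
    open ≤-Reasoning
    ℓ = span i
    K = (ℓ ^ 4) ^ (2 + i)
    P = (n ^ 4) ^ N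
    E = (n ^ 4) ^ (2 + i)
    S = ∑ (words N cycles) (λ h → ∑⊆ (2 + i) (crowding i) (toList h))
    avg : S * E ≤ N ^ (2 + i) * (P * ∑ (words (2 + i) cycles) (crowding i))
    avg = subst (λ l → S * l ^ (2 + i) ≤ N ^ (2 + i) * (l ^ N * ∑ (words (2 + i) cycles) (crowding i)))
            length-cycles (∑⊆-average cycles N (2 + i) (crowding i))
    swap : ∀ s q e → s * q * e ≡ s * e * q
    swap = solve-∀
    regroup : ∀ m mi p x y z q → m * (m * mi) * (p * (x * y * z)) * q ≡ p * (x * z * m) * (m * q * mi * y)
    regroup = solve-∀
    -- This balance singles out `2 * j + 2` vertices: `2 * (j - 1)` from the powers of `N * q` and
    -- `2 * j + 2` from the words add up to `4 * j`.
    degree : ∀ i → 2 * (1 + i) + 2 * (3 + i) ≡ 4 * (2 + i)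
    degree = solve-∀
    exponents : (N * q) ^ (1 + i) * n ^ ℓ ≡ E
    exponents = begin-equality
      (N * q) ^ (1 + i) * n ^ ℓ   ≡⟨ cong (λ z → z ^ (1 + i) * n ^ ℓ) Nq≡n² ⟩
      (n ^ 2) ^ (1 + i) * n ^ ℓ   ≡⟨ cong (_* n ^ ℓ) (^-*-assoc n 2 (1 + i)) ⟩
      n ^ (2 * (1 + i)) * n ^ ℓ   ≡⟨ sym (^-distribˡ-+-* n (2 * (1 + i)) ℓ) ⟩
      n ^ (2 * (1 + i) + ℓ)       ≡⟨ cong (n ^_) (degree i) ⟩
      n ^ (4 * (2 + i))           ≡⟨ sym (^-*-assoc n 4 (2 + i)) ⟩
      E                           ∎

-- Existence of a large dispersed family.

Dispersed : ℕ → List (FourCycle v) → Set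
Dispersed {v} r D = ∀ j → 2 ≤ j → j ≤ r → (σ : Fin j → Fin (length D)) → Injective _≡_ _≡_ σ →
  (w : List (Fin v)) → length w ≤ 2 * suc j → ¬ (∀ t → Covers w (lookup D (σ t)))

-- `crowding` ranges over words of one exact length, so shorter lists are filled up; repetition is
-- harmless since only membership has to persist.
pad : A → (xs : List A) → length xs ≤ k → Σ[ s ∈ Vec A k ] (∀ {x} → x ∈ xs → x ∈ toList s)
pad {k = k} u []       le = replicate k u , λ ()
pad         u (x ∷ xs) (s≤s le) with pad u xs le
... | s , xs⊆s = x ∷ s , λ { (here eq) → here eq ; (there x∈) → there (xs⊆s x∈) }

totalCrowding : ℕ → List (FourCycle v) → ℕ
totalCrowding r D = ∑ (upTo r) (λ i → ∑⊆ (2 + i) (crowding i) D)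

-- Cycles covered by a short list contribute at least 1 to `crowding`, through the single term of
-- the padded list.
uncrowded⇒dispersed : ∀ r (D : List (FourCycle v)) → totalCrowding r D ≡ 0 → Dispersed r D
uncrowded⇒dispersed r D D≡0 (suc (suc i)) (s≤s (s≤s _)) j≤r σ σ-inj w ∣w∣≤ covered
  -- Padding needs some vertex of `Fin v`; one is taken from the first of the cycles.
  with w⁺ , w⊆w⁺ ← pad (a (lookup D (σ zero))) w ∣w∣≤ =
  1+n≰n (begin
    1
      ≤⟨ ∑⊆-prod-positive (multC (toList w⁺)) D σ σ-inj
           (λ t → multC-positive {C = lookup D (σ t)} (Covers-mono {C = lookup D (σ t)} w⊆w⁺ (covered t))) ⟩
    ∑⊆ (2 + i) (prod (λ _ → multC (toList w⁺))) D
      ≤⟨ ∑⊆-mono (2 + i) (λ s → f≤∑ (λ w′ → prod (λ _ → multC (toList w′)) s) (∈-words ∈-allFin w⁺)) D ⟩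
    ∑⊆ (2 + i) (crowding i) D
      ≡⟨ ∑≡0⇒f≡0 (λ i → ∑⊆ (2 + i) (crowding i) D) (∈-upTo⁺ (≤-trans (n≤1+n _) j≤r)) D≡0 ⟩
    0 ∎)
  where open ≤-Reasoning

-- The `suc` makes positivity immediate, for cancellation and for division.
totalLoad : ℕ → ℕ
totalLoad r = suc (∑ (upTo r) load)

-- In `2 * totalLoad r`, the factor `totalLoad r` absorbs the loads of all sizes and the 2 brings
-- the mean weight down to `N / 2`. Pruning a word of at most mean weight then costs at most half of
-- its cycles.
dispersed-exists : ∀ r N → .{{_ : NonZero n}} → 4 * n ≤ v → v ≤ 8 * n → N * (2 * totalLoad r) ≡ n ^ 2 →
  Σ[ D ∈ List (FourCycle v) ] (Dispersed r D × N ≤ 2 * length D)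
dispersed-exists {n} {v} r N 4n≤v v≤8n Nq≡n² = D , uncrowded⇒dispersed r D (proj₁ (proj₂ pruned)) , N≤2∣D∣
  where
  open Partite n v 4n≤v
  open Deletion {FourCycle v} (upTo r) suc crowding
  open ≤-Reasoning
  K = totalLoad r
  P = (n ^ 4) ^ N
  S = ∑ (words N cycles) (weight ∘ toList)
  Si = λ i → ∑ (words N cycles) (λ h → ∑⊆ (2 + i) (crowding i) (toList h))

  2S≤PN : 2 * S ≤ P * N
  2S≤PN = *-cancelʳ-≤ _ _ K (begin
    2 * S * K
      ≡⟨ shift S K ⟩
    S * (2 * K)
      ≡⟨ cong (_* (2 * K)) (∑-comm (words N cycles) (upTo r) _) ⟩
    ∑ (upTo r) Si * (2 * K)
      ≡⟨ *-distribʳ-∑ (upTo r) Si (2 * K) ⟩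
    ∑ (upTo r) (λ i → Si i * (2 * K))
      ≤⟨ ∑-mono (upTo r) (crowding-average {n} 4n≤v N (2 * K) v≤8n Nq≡n²) ⟩
    ∑ (upTo r) (λ i → P * (load i * N))
      ≡⟨ sym (*-distribˡ-∑ (upTo r) _ P) ⟩
    P * ∑ (upTo r) (λ i → load i * N)
      ≡⟨ cong (P *_) (sym (*-distribʳ-∑ (upTo r) load N)) ⟩
    P * (∑ (upTo r) load * N)
      ≤⟨ *-monoʳ-≤ P (*-monoˡ-≤ N (n≤1+n (∑ (upTo r) load))) ⟩
    P * (K * N)
      ≡⟨ shift′ P K N ⟩
    P * N * K ∎)
    where
    shift : ∀ s k → 2 * s * k ≡ s * (2 * k)
    shift = solve-∀
    shift′ : ∀ p k m → p * (k * m) ≡ p * m * k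
    shift′ = solve-∀

  length-words-cycles : length (words N cycles) ≡ P
  length-words-cycles = trans (length-words N cycles) (cong (_^ N) length-cycles)

  light : ∃[ h ] 2 * weight (toList h) ≤ N
  light = pigeonhole (words N cycles) (λ h → 2 * weight (toList h)) N
    (subst (1 ≤_) (sym length-words-cycles) (m^n>0 (n ^ 4) {{m^n≢0 n 4}} N))
    (subst (_≤ length (words N cycles) * N) (*-distribˡ-∑ (words N cycles) (weight ∘ toList) 2)
      (subst (λ l → 2 * S ≤ l * N) (sym length-words-cycles) 2S≤PN))

  h = proj₁ light
  pruned = prune (toList h)
  D = proj₁ pruned

  N≤2∣D∣ : N ≤ 2 * length D
  N≤2∣D∣ = +-cancelʳ-≤ N _ _ (begin
    N + N                                        ≡⟨ cong (N +_) (sym (+-identityʳ N)) ⟩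
    2 * N                                        ≤⟨ *-monoʳ-≤ 2 N≤∣D∣+weight ⟩
    2 * (length D + weight (toList h))           ≡⟨ *-distribˡ-+ 2 (length D) _ ⟩
    2 * length D + 2 * weight (toList h)         ≤⟨ +-monoʳ-≤ (2 * length D) (proj₂ light) ⟩
    2 * length D + N                             ∎)
    where
    N≤∣D∣+weight : N ≤ length D + weight (toList h)
    N≤∣D∣+weight = subst (_≤ length D + weight (toList h)) (length-toList h) (proj₂ (proj₂ (proj₂ pruned)))

-- From dispersal to strictly sparse packings.

private
  pattern 0th = here refl
  pattern 1st = there 0th
  pattern 2nd = there 1st
  pattern 3rd = there 2nd

-- Listing the given edge first lets two cycles through a common edge share two entries, so that six
-- vertices cover both.
edge-covers : ∀ (C : FourCycle v) {x y} → Edge C x y → ∃[ p ] ∃[ q ] Covers (x ∷ y ∷ p ∷ q ∷ []) C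
edge-covers C (inj₁ (inj₁ (refl , refl))) = c C , d C , 0th , 1st , 2nd , 3rd
edge-covers C (inj₁ (inj₂ (refl , refl))) = c C , d C , 1st , 0th , 2nd , 3rd
edge-covers C (inj₂ (inj₁ (inj₁ (refl , refl)))) = a C , d C , 2nd , 0th , 1st , 3rd
edge-covers C (inj₂ (inj₁ (inj₂ (refl , refl)))) = a C , d C , 2nd , 1st , 0th , 3rd
edge-covers C (inj₂ (inj₂ (inj₁ (inj₁ (refl , refl))))) = a C , b C , 2nd , 3rd , 0th , 1st
edge-covers C (inj₂ (inj₂ (inj₁ (inj₂ (refl , refl))))) = a C , b C , 2nd , 3rd , 1st , 0th
edge-covers C (inj₂ (inj₂ (inj₂ (inj₁ (refl , refl))))) = b C , c C , 1st , 2nd , 3rd , 0th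
edge-covers C (inj₂ (inj₂ (inj₂ (inj₂ (refl , refl))))) = b C , c C , 0th , 2nd , 3rd , 1st

edge-endpoint : ∀ (C : FourCycle v) {w x y} → Edge C x y → Covers w C → x ∈ w
edge-endpoint C (inj₁ (inj₁ (refl , _))) (a∈ , b∈ , c∈ , d∈) = a∈
edge-endpoint C (inj₁ (inj₂ (refl , _))) (a∈ , b∈ , c∈ , d∈) = b∈
edge-endpoint C (inj₂ (inj₁ (inj₁ (refl , _)))) (a∈ , b∈ , c∈ , d∈) = b∈
edge-endpoint C (inj₂ (inj₁ (inj₂ (refl , _)))) (a∈ , b∈ , c∈ , d∈) = c∈
edge-endpoint C (inj₂ (inj₂ (inj₁ (inj₁ (refl , _))))) (a∈ , b∈ , c∈ , d∈) = c∈
edge-endpoint C (inj₂ (inj₂ (inj₁ (inj₂ (refl , _))))) (a∈ , b∈ , c∈ , d∈) = d∈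
edge-endpoint C (inj₂ (inj₂ (inj₂ (inj₁ (refl , _))))) (a∈ , b∈ , c∈ , d∈) = d∈
edge-endpoint C (inj₂ (inj₂ (inj₂ (inj₂ (refl , _))))) (a∈ , b∈ , c∈ , d∈) = a∈

-- `SameCycle` speaks only of edges, so each vertex of `C₀` is recovered as the first endpoint of an
-- edge.
SameCycle-covers : ∀ {w} (C₀ C : FourCycle v) → SameCycle C₀ C → Covers w C → Covers w C₀
SameCycle-covers C₀ C same cov =
  endpoint (inj₁ (inj₁ (refl , refl))) ,
  endpoint (inj₂ (inj₁ (inj₁ (refl , refl)))) ,
  endpoint (inj₂ (inj₂ (inj₁ (inj₁ (refl , refl))))) ,
  endpoint (inj₂ (inj₂ (inj₂ (inj₁ (refl , refl)))))
  where
  endpoint : ∀ {x y} → Edge C₀ x y → x ∈ _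
  endpoint e = edge-endpoint C (proj₁ (same _ _) e) cov

onCycle⁺ : ∀ (C : FourCycle v) {x} → x ∈ a C ∷ b C ∷ c C ∷ d C ∷ [] → T (onCycle x C)
onCycle⁺ C {x} x∈ with x ≟F a C
... | yes _ = _
... | no x≢a with x ≟F b C
...   | yes _ = _
...   | no x≢b with x ≟F c C
...     | yes _ = _
...     | no x≢c with x ≟F d C
...       | yes _ = _
onCycle⁺ C (here x≡a)                 | no x≢a | no _   | no _   | no _ = x≢a x≡a
onCycle⁺ C (there (here x≡b))         | no _   | no x≢b | no _   | no _ = x≢b x≡b
onCycle⁺ C (there (there (here x≡c))) | no _   | no _   | no x≢c | no _ = x≢c x≡c
onCycle⁺ C (there (there (there (here x≡d)))) | no _ | no _ | no _ | no x≢d = x≢d x≡d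

module _ (D : List (FourCycle v)) {r} (2≤r : 2 ≤ r) (disp : Dispersed r D) where

  -- The case `j = 2` of dispersal, where `2 * suc j` is 6.
  no-crowded-pair : ∀ {i j} → i ≢ j → (w : List (Fin v)) → length w ≤ 6 →
                    Covers w (lookup D i) → ¬ Covers w (lookup D j)
  no-crowded-pair {i} {j} i≢j w le covi covj = disp 2 ≤-refl 2≤r σ σ-injective w le λ where
      zero       → covi
      (suc zero) → covj
    where
    σ : Fin 2 → Fin (length D)
    σ zero       = i
    σ (suc zero) = j
    σ-injective : Injective _≡_ _≡_ σ
    σ-injective {zero}     {zero}     eq = refl
    σ-injective {zero}     {suc zero} eq = contradiction eq i≢j
    σ-injective {suc zero} {zero}     eq = contradiction (sym eq) i≢j
    σ-injective {suc zero} {suc zero} eq = refl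

  dispersed⇒packing : IsPacking D
  dispersed⇒packing i j i≢j (x , y , ei , ej)
    with p , q , covi ← edge-covers (lookup D i) ei
       | s , t , covj ← edge-covers (lookup D j) ej =
    no-crowded-pair i≢j (x ∷ y ∷ p ∷ q ∷ s ∷ t ∷ []) ≤-refl
      (Covers-mono {C = lookup D i} (λ where
        0th → 0th
        1st → 1st
        2nd → 2nd
        3rd → 3rd) covi)
      (Covers-mono {C = lookup D j} (λ where
        0th → 0th
        1st → 1st
        2nd → there 3rd
        3rd → there (there 3rd)) covj)

  dispersed⇒avoiding : DAvoiding D
  dispersed⇒avoiding (i , j , i≢j , C , C′ , same , same′ , a≡ , c≡ , _) =
    -- The common diagonal followed by the two remaining vertices of each cycle.
    no-crowded-pair i≢j (a C ∷ c C ∷ b C ∷ d C ∷ b C′ ∷ d C′ ∷ []) ≤-refl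
      (SameCycle-covers (lookup D i) C same (0th , 2nd , 1st , 3rd))
      (SameCycle-covers (lookup D j) C′ same′
        (here (sym a≡) , there 3rd , there (here (sym c≡)) , there (there 3rd)))

  dispersed⇒sparse : Sparse r D
  dispersed⇒sparse j 2≤j j≤r (σ , σ-inj , size≡) =
    -- The covering list, left to unification, is the filtered vertex list whose length is
    -- `unionSize D σ`.
    disp j 2≤j j≤r σ σ-inj _ (≤-trans (≤-reflexive size≡) j+3≤2[1+j]) λ t →
      ∈union t 0th , ∈union t 1st , ∈union t 2nd , ∈union t 3rd
    where
    C : Fin j → FourCycle v
    C t = lookup D (σ t)
    onAny : Fin v → Bool
    onAny x = any (λ t → onCycle x (C t)) (allFin j)
    ∈union : ∀ t {x} → x ∈ a (C t) ∷ b (C t) ∷ c (C t) ∷ d (C t) ∷ [] → x ∈ filterᵇ onAny (allFin v)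
    ∈union t {x} x∈ = ∈-filter⁺ (T? ∘ onAny) (∈-allFin x)
      (Any.any⁺ (λ t → onCycle x (C t)) (Any.map (λ { refl → onCycle⁺ (C t) x∈ }) (∈-allFin t)))
    j+3≤2[1+j] : j + 3 ≤ 2 * suc j
    j+3≤2[1+j] = begin
      j + 3           ≤⟨ +-monoʳ-≤ j (s≤s 2≤j) ⟩
      j + suc j       ≤⟨ +-mono-≤ (n≤1+n j) (≤-reflexive (sym (+-identityʳ (suc j)))) ⟩
      2 * suc j       ∎
      where open ≤-Reasoning

-- Choice of parameters.

sparsePacking : ∀ r → 2 ≤ r → ∀ q .{{_ : NonZero q}} → q ≡ 2 * totalLoad r → ∀ v → 4 * q ≤ v →
  Σ[ D ∈ List (FourCycle v) ] (IsPacking D × StrictlySparse r D × 1 * v ^ 2 ≤ 128 * q * length D)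
sparsePacking r 2≤r q q≡ v 4q≤v =
  D , dispersed⇒packing D 2≤r disp , (dispersed⇒sparse D 2≤r disp , dispersed⇒avoiding D 2≤r disp) , many
  where
  open ≤-Reasoning
  -- With `n = q * t`, a multiple of `q`, the quotient `n ^ 2 / q` is the exact integer `N` below.
  t = v / (4 * q)
  instance
    _ = m*n≢0 4 q
    t≢0 : NonZero t
    t≢0 = >-nonZero (m≥n⇒m/n>0 4q≤v)
    qt≢0 : NonZero (q * t)
    qt≢0 = m*n≢0 q t
  N = q * t ^ 2
  4n≡ : ∀ q t → t * (4 * q) ≡ 4 * (q * t)
  4n≡ = solve-∀
  8n≡ : ∀ q t → 4 * q * t + 4 * (q * t) ≡ 8 * (q * t)
  8n≡ = solve-∀
  n²≡ : ∀ q t → q * (t * (t * 1)) * q ≡ q * t * (q * t * 1)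
  n²≡ = solve-∀
  64n²≡ : ∀ q t → 8 * (q * t) * (8 * (q * t) * 1) ≡ 64 * q * (q * (t * (t * 1)))
  64n²≡ = solve-∀
  128≡ : ∀ q l → 64 * q * (2 * l) ≡ 128 * q * l
  128≡ = solve-∀
  4n≤v : 4 * (q * t) ≤ v
  4n≤v = subst (_≤ v) (4n≡ q t) (m/n*n≤m v (4 * q))
  -- The remainder is below `4 * q`, hence at most `4 * q * t` because `t` is nonzero.
  v≤8n : v ≤ 8 * (q * t)
  v≤8n = begin
    v                                  ≡⟨ m≡m%n+[m/n]*n v (4 * q) ⟩
    v % (4 * q) + t * (4 * q)          ≤⟨ +-mono-≤ (<⇒≤ (m%n<n v (4 * q))) (≤-reflexive (4n≡ q t)) ⟩
    4 * q + 4 * (q * t)                ≤⟨ +-monoˡ-≤ (4 * (q * t)) (m≤m*n (4 * q) t) ⟩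
    4 * q * t + 4 * (q * t)            ≡⟨ 8n≡ q t ⟩
    8 * (q * t)                        ∎
  dispersed = dispersed-exists {q * t} r N 4n≤v v≤8n
    (subst (λ z → N * z ≡ (q * t) ^ 2) q≡ (n²≡ q t))
  D = proj₁ dispersed
  disp = proj₁ (proj₂ dispersed)
  many : 1 * v ^ 2 ≤ 128 * q * length D
  many = begin
    1 * v ^ 2                ≡⟨ *-identityˡ (v ^ 2) ⟩
    v ^ 2                    ≤⟨ ^-monoˡ-≤ 2 v≤8n ⟩
    (8 * (q * t)) ^ 2        ≡⟨ 64n²≡ q t ⟩
    64 * q * N               ≤⟨ *-monoʳ-≤ (64 * q) (proj₂ (proj₂ dispersed)) ⟩
    64 * q * (2 * length D)  ≡⟨ 128≡ q (length D) ⟩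
    128 * q * length D       ∎

theorem9 : ∀ (r : ℕ) → 2 ≤ r →
    Σ[ p ∈ ℕ ] Σ[ q ∈ ℕ ] (1 ≤ p × 1 ≤ q × Σ[ v₀ ∈ ℕ ] (∀ (v : ℕ) → v₀ ≤ v →
    Σ[ D ∈ List (FourCycle v) ]
    (IsPacking D × StrictlySparse r D × p * v ^ 2 ≤ q * length D)))
-- The constant is `c = 1 / (128 * q)`: 64 from squaring `v ≤ 8 * n`, 2 from the deletions and `q`
-- from the density of `N`. The threshold `4 * q` makes `t` nonzero.
theorem9 r 2≤r = 1 , 128 * q , s≤s z≤n , s≤s z≤n , 4 * q , sparsePacking r 2≤r q refl
  where q = 2 * totalLoad r
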